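{- Let $n\ge 1$ and $k\ge 1$ be integers and let $\mathbf y\in\{ -k,\dots,k\}^n$ be an unknown vector. There is an algorithm that chooses query vectors $\mathbf x^{(1)},\dots,\mathbf x^{(s)}$ and, given the answers $\|\mathbf x^{(j)}-\mathbf y\|_\infty$ for $j=1,\dots,s$, recovers $\mathbf y$ exactly, where $s=O(n)$, and which runs in time polynomial in $n$ and $k$.
   Context: $\|\mathbf z\|_\infty=\max_{1\le i\le n}|z_i|$. The algorithm learns about $\mathbf y$ only through the answers to its queries. -}

module Defs where

open import Data.Bool using (if_then_else_)
open import Data.Fin using (Fin; toℕ)
open import Data.Integer as ℤ using (ℤ; +_; 0ℤ; ∣_∣)
open import Data.List using (List; []; [_]; _++_)
open import Data.Nat as ℕ using (ℕ; zero; suc; _⊔_)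
open import Data.Product using (_×_)
open import Data.Vec as Vec using (Vec)
open import Data.Vec.Relation.Unary.All using (All)
open import Relation.Nullary.Decidable using (does)

‖_‖∞ : ∀ {n} → Vec ℤ n → ℕ
‖ z ‖∞ = Vec.foldr′ _⊔_ 0 (Vec.map ∣_∣ z)

infixl 6 _-ᵛ_

_-ᵛ_ : ∀ {n} → Vec ℤ n → Vec ℤ n → Vec ℤ n
_-ᵛ_ = Vec.zipWith ℤ._-_

InBox : ∀ {n} → ℕ → Vec ℤ n → Set
InBox k = All (λ z → (ℤ.- (+ k)) ℤ.≤ z × z ℤ.≤ + k)

-- Algorithms are programs of a structured random access machine with an
-- oracle: finitely many integer variables, integer arrays, addition and
-- subtraction at unit cost.  As there is no multiplication, t steps produce
-- numbers of bit length O(t + log n + log k), so polynomial time here is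
-- polynomial time on a Turing machine.  A program is a finite syntactic object
-- which does not depend on n, k or the hidden vector.

Var Arr : Set
Var = ℕ
Arr = ℕ

infixl 6 _⊕_ _⊖_
infix  5 _≔_ _⟦_⟧≔_ _≼_
infixr 4 _⨾_

data Expr : Set where
  lit     : ℤ → Expr
  var     : Var → Expr
  _⟦_⟧    : Arr → Expr → Expr
  _⊕_ _⊖_ : Expr → Expr → Expr

data Cond : Set where
  _≼_ : Expr → Expr → Cond

-- `query x a` submits the first n entries of the array a (n being the length of
-- the hidden vector) to the oracle and stores the answer in the variable x.
data Cmd : Set where
  skip    : Cmd
  _≔_     : Var → Expr → Cmd
  _⟦_⟧≔_  : Arr → Expr → Expr → Cmd
  _⨾_     : Cmd → Cmd → Cmd
  ifᶜ     : Cond → Cmd → Cmd → Cmd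
  while   : Cond → Cmd → Cmd
  query   : Var → Arr → Cmd

record State : Set where
  constructor state
  field
    vars : Var → ℤ
    arrs : Arr → ℤ → ℤ

open State public

setVar : Var → ℤ → State → State
setVar x v σ = state (λ y → if does (x ℕ.≟ y) then v else vars σ y) (arrs σ)

setArr : Arr → ℤ → ℤ → State → State
setArr a i v σ = state (vars σ) λ b j →
  if does (a ℕ.≟ b) then (if does (i ℤ.≟ j) then v else arrs σ b j)
                    else arrs σ b j

eval : Expr → State → ℤ
eval (lit z)   σ = z
eval (var x)   σ = vars σ x
eval (a ⟦ e ⟧) σ = arrs σ a (eval e σ)
eval (e ⊕ f)   σ = eval e σ ℤ.+ eval f σ
eval (e ⊖ f)   σ = eval e σ ℤ.- eval f σ

cost : Expr → ℕ
cost (lit z)   = 1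
cost (var x)   = 1
cost (a ⟦ e ⟧) = suc (cost e)
cost (e ⊕ f)   = suc (cost e ℕ.+ cost f)
cost (e ⊖ f)   = suc (cost e ℕ.+ cost f)

costᶜ : Cond → ℕ
costᶜ (e ≼ f) = suc (cost e ℕ.+ cost f)

True False : Cond → State → Set
True  (e ≼ f) σ = eval e σ ℤ.≤ eval f σ
False (e ≼ f) σ = eval f σ ℤ.< eval e σ

prefix : ∀ n → (ℤ → ℤ) → Vec ℤ n
prefix n a = Vec.tabulate λ (i : Fin n) → a (+ toℕ i)

-- `ask ⊢ c , σ ⇓ σ′ ∥ t ∥ qs`: with oracle ask, the program c started in σ
-- halts in σ′ after t units of time, having asked the queries qs in this order.
-- Reading a query of length n is charged n units.  The rules are deterministic
-- and reach the hidden vector only through ask.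
infix 3 _⊢_,_⇓_∥_∥_

data _⊢_,_⇓_∥_∥_ {n : ℕ} (ask : Vec ℤ n → ℕ) :
       Cmd → State → State → ℕ → List (Vec ℤ n) → Set where

  ⇓skip : ∀ {σ} → ask ⊢ skip , σ ⇓ σ ∥ 1 ∥ []

  ⇓var : ∀ {σ x e} →
    ask ⊢ x ≔ e , σ ⇓ setVar x (eval e σ) σ ∥ suc (cost e) ∥ []

  ⇓arr : ∀ {σ a e f} →
    ask ⊢ a ⟦ e ⟧≔ f , σ ⇓ setArr a (eval e σ) (eval f σ) σ
        ∥ suc (cost e ℕ.+ cost f) ∥ []

  ⇓seq : ∀ {σ σ′ σ″ c d t u ps qs} →
    ask ⊢ c , σ ⇓ σ′ ∥ t ∥ ps →
    ask ⊢ d , σ′ ⇓ σ″ ∥ u ∥ qs →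
    ask ⊢ c ⨾ d , σ ⇓ σ″ ∥ t ℕ.+ u ∥ ps ++ qs

  ⇓then : ∀ {σ σ′ b c d t qs} →
    True b σ →
    ask ⊢ c , σ ⇓ σ′ ∥ t ∥ qs →
    ask ⊢ ifᶜ b c d , σ ⇓ σ′ ∥ costᶜ b ℕ.+ t ∥ qs

  ⇓else : ∀ {σ σ′ b c d t qs} →
    False b σ →
    ask ⊢ d , σ ⇓ σ′ ∥ t ∥ qs →
    ask ⊢ ifᶜ b c d , σ ⇓ σ′ ∥ costᶜ b ℕ.+ t ∥ qs

  ⇓stop : ∀ {σ b c} →
    False b σ →
    ask ⊢ while b c , σ ⇓ σ ∥ costᶜ b ∥ []

  ⇓loop : ∀ {σ σ′ σ″ b c t u ps qs} →
    True b σ →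
    ask ⊢ c , σ ⇓ σ′ ∥ t ∥ ps →
    ask ⊢ while b c , σ′ ⇓ σ″ ∥ u ∥ qs →
    ask ⊢ while b c , σ ⇓ σ″ ∥ costᶜ b ℕ.+ (t ℕ.+ u) ∥ ps ++ qs

  ⇓query : ∀ {σ x a} →
    ask ⊢ query x a , σ ⇓ setVar x (+ ask (prefix n (arrs σ a))) σ
        ∥ suc n ∥ [ prefix n (arrs σ a) ]

-- Variable 0 initially holds n and variable 1 holds k; everything else is 0.
initial : ℕ → ℕ → State
initial n k = setVar 0 (+ n) (setVar 1 (+ k) (state (λ _ → 0ℤ) (λ _ _ → 0ℤ)))

-- The result is left in array 0.
output : ∀ n → State → Vec ℤ n
output n σ = prefix n (arrs σ 0)

distanceTo : ∀ {n} → Vec ℤ n → Vec ℤ n → ℕ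
distanceTo y x = ‖ x -ᵛ y ‖∞

-- For every i query ∓k eᵢ, with answers a and b.  The other coordinates contribute
-- at most k to an answer, while coordinate i contributes k + |yᵢ| to one answer and
-- k − |yᵢ| to the other.  Hence b ≤ k and a = k + yᵢ if yᵢ ≥ 0, and b = k − yᵢ > k
-- if yᵢ < 0, so that 2n queries reveal y.

module Submission where

open import Defs
open import Data.Fin as Fin using (Fin; toℕ; fromℕ<)
open import Data.Fin.Properties using (toℕ-injective; toℕ-fromℕ<; toℕ<n)
open import Data.Integer as ℤ using (ℤ; +_; -[1+_]; 0ℤ; ∣_∣)
import Data.Integer.Properties as ℤ
open import Data.List using (length; []; _∷_)
open import Data.List.Properties using (length-++)
open import Data.List.Relation.Unary.All using (All; []; _∷_)
open import Data.List.Relation.Unary.All.Properties using (++⁺)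
open import Data.Nat using (ℕ; zero; suc; _+_; _*_; _^_; _≤_; _<_; z≤n; s≤s)
open import Data.Nat.Properties
open import Data.Nat.Tactic.RingSolver using (solve-∀)
open import Data.Product using (∃-syntax; _×_; _,_)
open import Data.Vec using (Vec; []; _∷_; lookup)
open import Data.Vec.Properties using (lookup∘tabulate; tabulate∘lookup; tabulate-cong; lookup-zipWith)
import Data.Vec.Relation.Unary.All as Vec
import Data.Vec.Relation.Unary.All.Properties as Vec
open import Relation.Binary.PropositionalEquality
open import Relation.Nullary using (yes; no)
open import Relation.Nullary.Decidable using (dec-true; dec-false)

-- The maximum norm and probes supported on one coordinate.

∣lookup∣≤‖‖∞ : ∀ {n} (z : Vec ℤ n) i → ∣ lookup z i ∣ ≤ ‖ z ‖∞
∣lookup∣≤‖‖∞ (x ∷ z) Fin.zero    = m≤m⊔n ∣ x ∣ ‖ z ‖∞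
∣lookup∣≤‖‖∞ (x ∷ z) (Fin.suc i) = ≤-trans (∣lookup∣≤‖‖∞ z i) (m≤n⊔m ∣ x ∣ ‖ z ‖∞)

‖‖∞-least : ∀ {n m} (z : Vec ℤ n) → (∀ i → ∣ lookup z i ∣ ≤ m) → ‖ z ‖∞ ≤ m
‖‖∞-least []      h = z≤n
‖‖∞-least (x ∷ z) h = ⊔-lub (h Fin.zero) (‖‖∞-least z (λ i → h (Fin.suc i)))

-- Stated for arrays rather than vectors, so that it can be followed through the states of the
-- program. The indices are natural numbers because `prefix` reads no others.
record Spike (f : ℤ → ℤ) (i : ℕ) (v : ℤ) : Set where
  constructor spike
  field
    peak : f (+ i) ≡ v
    flat : ∀ j → j ≢ i → f (+ j) ≡ 0ℤ

open Spike

∣i∣≤k : ∀ {k i} → ℤ.- (+ k) ℤ.≤ i × i ℤ.≤ + k → ∣ i ∣ ≤ k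
∣i∣≤k {i = + p}     (_ , p≤k)           = ℤ.drop‿+≤+ p≤k
∣i∣≤k {suc k} { -[1+ p ]} (ℤ.-≤- p≤k , _) = s≤s p≤k

lookup-difference : ∀ {n} (f : ℤ → ℤ) (y : Vec ℤ n) j →
  lookup (prefix n f -ᵛ y) j ≡ f (+ toℕ j) ℤ.- lookup y j
lookup-difference f y j =
  trans (lookup-zipWith ℤ._-_ j (prefix _ f) y)
        (cong (ℤ._- lookup y j) (lookup∘tabulate (λ i → f (+ toℕ i)) j))

module _ {n k : ℕ} (y : Vec ℤ n) (y∈box : InBox k y) where

  spike-distance-≥ : ∀ {f v} (i : Fin n) → Spike f (toℕ i) v →
    ∣ v ℤ.- lookup y i ∣ ≤ distanceTo y (prefix n f)
  spike-distance-≥ {f} i s = subst (λ z → ∣ z ∣ ≤ _)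
    (trans (lookup-difference f y i) (cong (ℤ._- lookup y i) (peak s)))
    (∣lookup∣≤‖‖∞ (prefix n f -ᵛ y) i)

  -- Away from `i` the difference is `- lookup y j`, of absolute value at most `k ≤ m`. The bound
  -- `m` is left free because two values are used: `k` itself and the distance at coordinate `i`.
  spike-distance-≤ : ∀ {f v m} (i : Fin n) → Spike f (toℕ i) v → k ≤ m →
    ∣ v ℤ.- lookup y i ∣ ≤ m → distanceTo y (prefix n f) ≤ m
  spike-distance-≤ {f} {v} {m} i s k≤m v≤m = ‖‖∞-least (prefix n f -ᵛ y) entry
    where
    entry : ∀ j → ∣ lookup (prefix n f -ᵛ y) j ∣ ≤ m
    entry j rewrite lookup-difference f y j with j Fin.≟ i
    ... | yes refl rewrite peak s = v≤m
    ... | no j≢i rewrite flat s (toℕ j) (λ e → j≢i (toℕ-injective e))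
                       | ℤ.+-identityˡ (ℤ.- lookup y j)
                       | ℤ.∣-i∣≡∣i∣ (lookup y j) =
      ≤-trans (∣i∣≤k (Vec.lookup⁺ y∈box j)) k≤m

  spike-distance : ∀ {f v} (i : Fin n) → Spike f (toℕ i) v →
    k ≤ ∣ v ℤ.- lookup y i ∣ →
    distanceTo y (prefix n f) ≡ ∣ v ℤ.- lookup y i ∣
  spike-distance i s k≤ =
    ≤-antisym (spike-distance-≤ i s k≤ ≤-refl) (spike-distance-≥ i s)

-- Recovering one coordinate from its two answers.

∣-k-p∣≡k+p : ∀ k p → ∣ ℤ.- (+ k) ℤ.- + p ∣ ≡ k + p
∣-k-p∣≡k+p k p = begin
  ∣ ℤ.- (+ k) ℤ.- + p ∣     ≡⟨ cong ∣_∣ (ℤ.neg-distrib-+ (+ k) (+ p)) ⟨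
  ∣ ℤ.- (+ k ℤ.+ + p) ∣     ≡⟨ ℤ.∣-i∣≡∣i∣ (+ (k + p)) ⟩
  k + p                     ∎
  where open ≡-Reasoning

∣k-p∣≤k : ∀ {k p} → p ≤ k → ∣ + k ℤ.- + p ∣ ≤ k
∣k-p∣≤k {k} {p} p≤k rewrite ℤ.m-n≡m⊖n k p | ℤ.⊖-≥ p≤k = m∸n≤m k p

k+p-k≡p : ∀ k i → + k ℤ.+ i ℤ.- + k ≡ i
k+p-k≡p k i rewrite ℤ.+-comm (+ k) i | ℤ.+-assoc i (+ k) (ℤ.- (+ k)) | ℤ.+-inverseʳ (+ k) =
  ℤ.+-identityʳ i

k-[k-i]≡i : ∀ k i → + k ℤ.- (+ k ℤ.- i) ≡ i
k-[k-i]≡i k i rewrite ℤ.neg-distrib-+ (+ k) (ℤ.- i) | ℤ.neg-involutive i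
  | sym (ℤ.+-assoc (+ k) (ℤ.- (+ k)) i) | ℤ.+-inverseʳ (+ k) = ℤ.+-identityˡ i

-- The constructors mirror the branches of the conditional in `body`: the outcome of its test and
-- the value then stored.
data Decoded (k a b : ℕ) (v : ℤ) : Set where
  nonneg : b ≤ k → + a ℤ.- + k ≡ v → Decoded k a b v
  neg    : k < b → + k ℤ.- + b ≡ v → Decoded k a b v

decode : ∀ {n k} (y : Vec ℤ n) → InBox k y → ∀ {f g} (i : Fin n) →
  Spike f (toℕ i) (ℤ.- (+ k)) → Spike g (toℕ i) (+ k) →
  Decoded k (distanceTo y (prefix n f)) (distanceTo y (prefix n g)) (lookup y i)
decode {n} {k} y y∈box {f} {g} i sf sg
  -- Abstracting the distance facts together with `lookup y i` lets them specialise to its sign. The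
  -- equalities still await a proof that the distance at coordinate `i` is at least `k`.
  with lookup y i | ∣i∣≤k (Vec.lookup⁺ y∈box i)
     | spike-distance y y∈box i sf | spike-distance-≤ y y∈box {m = k} i sg ≤-refl
     | spike-distance y y∈box i sg
... | + p | p≤k | a≡ | b≤ | _ = nonneg (b≤ (∣k-p∣≤k p≤k)) (begin
    + distanceTo y (prefix n f) ℤ.- + k  ≡⟨ cong (λ a → + a ℤ.- + k) (trans (a≡ k≤) (∣-k-p∣≡k+p k p)) ⟩
    + (k + p) ℤ.- + k                    ≡⟨ k+p-k≡p k (+ p) ⟩
    + p                                  ∎)
  where
  open ≡-Reasoning
  k≤ : k ≤ ∣ ℤ.- (+ k) ℤ.- + p ∣
  k≤ = subst (k ≤_) (sym (∣-k-p∣≡k+p k p)) (m≤m+n k p)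
-- Subtracting the negative entry from `+ k` computes to `+ (k + suc p)`, so the second answer
-- strictly exceeds `k`.
... | -[1+ p ] | _ | _ | _ | b≡ =
  neg (subst (k <_) (sym b≡k+1+p) (m<m+n k (s≤s z≤n)))
      (trans (cong (λ b → + k ℤ.- + b) b≡k+1+p) (k-[k-i]≡i k -[1+ p ]))
  where
  b≡k+1+p : distanceTo y (prefix n g) ≡ k + suc p
  b≡k+1+p = b≡ (m≤m+n k (suc p))

-- Array updates.

setArr-hit : ∀ a {i j v} σ → i ≡ j → arrs (setArr a i v σ) a j ≡ v
setArr-hit a {i} {j} σ i≡j rewrite dec-true (a ≟ a) refl | dec-true (i ℤ.≟ j) i≡j = refl

setArr-miss : ∀ a {i j v} σ → i ≢ j → arrs (setArr a i v σ) a j ≡ arrs σ a j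
setArr-miss a {i} {j} σ i≢j rewrite dec-true (a ≟ a) refl | dec-false (i ℤ.≟ j) i≢j = refl

-- Only entries other than `i` must vanish beforehand, so one spike can overwrite another at the
-- same index.
setArr-spike : ∀ a {i x u v} σ → x ≡ + i → u ≡ v → (∀ j → j ≢ i → arrs σ a (+ j) ≡ 0ℤ) →
  Spike (arrs (setArr a x u σ) a) i v
setArr-spike a σ refl refl h = spike (setArr-hit a σ refl) λ j j≢i →
  trans (setArr-miss a σ (λ e → j≢i (sym (ℤ.+-injective e)))) (h j j≢i)

-- The program.

len bound idx ansˡ ansʳ : Var
len   = 0
bound = 1
idx   = 2
ansˡ  = 3
ansʳ  = 4

out probe : Arr
out   = 0
probe = 1

-- Encodes the strict inequality `idx < len`, as conditions offer only `≼`.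
running : Cond
running = var idx ⊕ lit (+ 1) ≼ var len

body : Cmd
body =
  probe ⟦ var idx ⟧≔ lit 0ℤ ⊖ var bound ⨾
  query ansˡ probe ⨾
  probe ⟦ var idx ⟧≔ var bound ⨾
  query ansʳ probe ⨾
  -- Clearing the entry makes the probe zero again for the next coordinate.
  probe ⟦ var idx ⟧≔ lit 0ℤ ⨾
  ifᶜ (var ansʳ ≼ var bound)
    (out ⟦ var idx ⟧≔ var ansˡ ⊖ var bound)
    (out ⟦ var idx ⟧≔ var bound ⊖ var ansʳ) ⨾
  idx ≔ var idx ⊕ lit (+ 1)

-- Correctness and cost of the program.

module _ {n k : ℕ} (y : Vec ℤ n) (y∈box : InBox k y) where

  record Invariant (i : ℕ) (σ : State) : Set where
    field
      len≡    : vars σ len ≡ + n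
      bound≡  : vars σ bound ≡ + k
      idx≡    : vars σ idx ≡ + i
      probe≡0 : ∀ j → arrs σ probe (+ j) ≡ 0ℤ
      out≡y   : ∀ (j : Fin n) → toℕ j < i → arrs σ out (+ toℕ j) ≡ lookup y j

  open Invariant

  -- The entries off the spike are 0, which lies between `-k` and `k`.
  spike-inBox : ∀ {f i v} → Spike f i v → ℤ.- (+ k) ℤ.≤ v × v ℤ.≤ + k → InBox k (prefix n f)
  spike-inBox {f} {i} {v} s v∈box = Vec.tabulate⁺ λ j → entry (toℕ j)
    where
    entry : ∀ j → ℤ.- (+ k) ℤ.≤ f (+ j) × f (+ j) ℤ.≤ + k
    entry j with j ≟ i
    ... | yes refl rewrite peak s = v∈box
    ... | no j≢i rewrite flat s j j≢i = ℤ.neg-≤-pos {k} {0} , ℤ.+≤+ z≤n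

  body-correct : ∀ (i : Fin n) {σ} → Invariant (toℕ i) σ →
    ∃[ σ′ ] ∃[ t ] ∃[ qs ]
      ((distanceTo y ⊢ body , σ ⇓ σ′ ∥ t ∥ qs)
       × Invariant (suc (toℕ i)) σ′
       × All (InBox k) qs
       × length qs ≡ 2
       × t ≡ 25 + 2 * n)
  body-correct i {σ} inv = result
    where
    -k k′ a b : ℤ
    -k = 0ℤ ℤ.- vars σ bound
    k′ = vars σ bound
    σ₁ σ₂ σ₃ σ₄ σ₅ : State
    σ₁ = setArr probe (vars σ idx) -k σ
    a  = + distanceTo y (prefix n (arrs σ₁ probe))
    σ₂ = setVar ansˡ a σ₁
    σ₃ = setArr probe (vars σ idx) k′ σ₂
    b  = + distanceTo y (prefix n (arrs σ₃ probe))
    σ₄ = setVar ansʳ b σ₃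
    σ₅ = setArr probe (vars σ idx) 0ℤ σ₄

    spike₁ : Spike (arrs σ₁ probe) (toℕ i) (ℤ.- (+ k))
    spike₁ = setArr-spike probe σ (idx≡ inv)
      (trans (ℤ.+-identityˡ (ℤ.- k′)) (cong ℤ.-_ (bound≡ inv))) (λ j _ → probe≡0 inv j)

    spike₃ : Spike (arrs σ₃ probe) (toℕ i) (+ k)
    spike₃ = setArr-spike probe σ₂ (idx≡ inv) (bound≡ inv) (flat spike₁)

    spike₅ : Spike (arrs σ₅ probe) (toℕ i) 0ℤ
    spike₅ = setArr-spike probe σ₄ (idx≡ inv) refl (flat spike₃)

    -- The stored value is left open, so that both branches share one proof of the invariant.
    σ₆ : ℤ → State
    σ₆ v = setVar idx (vars σ idx ℤ.+ + 1) (setArr out (vars σ idx) v σ₅)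

    inv₆ : ∀ {v} → v ≡ lookup y i → Invariant (suc (toℕ i)) (σ₆ v)
    inv₆ v≡y .len≡   = len≡ inv
    inv₆ v≡y .bound≡ = bound≡ inv
    inv₆ v≡y .idx≡   = trans (cong (ℤ._+ + 1) (idx≡ inv)) (cong +_ (+-comm (toℕ i) 1))
    inv₆ v≡y .probe≡0 j with j ≟ toℕ i
    ... | yes refl = peak spike₅
    ... | no j≢i   = flat spike₅ j j≢i
    inv₆ v≡y .out≡y j j<1+i with j Fin.≟ i
    ... | yes refl = trans (setArr-hit out σ₅ (idx≡ inv)) v≡y
    ... | no j≢i   = trans
      (setArr-miss out σ₅ λ e → j≢i (toℕ-injective (ℤ.+-injective (trans (sym e) (idx≡ inv)))))
      (out≡y inv j (≤∧≢⇒< (≤-pred j<1+i) (λ e → j≢i (toℕ-injective e))))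

    boxed : All (InBox k) (prefix n (arrs σ₁ probe) ∷ prefix n (arrs σ₃ probe) ∷ [])
    boxed = spike-inBox spike₁ (ℤ.≤-refl , ℤ.neg-≤-pos {k} {k})
          ∷ spike-inBox spike₃ (ℤ.neg-≤-pos {k} {k} , ℤ.≤-refl) ∷ []

    -- One summand per command of `body`. The conditional costs 8 in either branch, 3 for its test
    -- and 5 for the assignment, which is why the time is exact.
    time≡ : ∀ n → 5 + (suc n + (3 + (suc n + (3 + (8 + 4))))) ≡ 25 + 2 * n
    time≡ = solve-∀

    result : _
    result with decode y y∈box i spike₁ spike₃
    ... | nonneg b≤k v≡y = σ₆ (a ℤ.- k′) , _ , _ ,
      ⇓seq ⇓arr (⇓seq ⇓query (⇓seq ⇓arr (⇓seq ⇓query (⇓seq ⇓arr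
        (⇓seq (⇓then (subst (b ℤ.≤_) (sym (bound≡ inv)) (ℤ.+≤+ b≤k)) ⇓arr) ⇓var))))) ,
      inv₆ (trans (cong (λ z → a ℤ.- z) (bound≡ inv)) v≡y) , boxed , refl , time≡ n
    ... | neg k<b v≡y = σ₆ (k′ ℤ.- b) , _ , _ ,
      ⇓seq ⇓arr (⇓seq ⇓query (⇓seq ⇓arr (⇓seq ⇓query (⇓seq ⇓arr
        (⇓seq (⇓else (subst (ℤ._< b) (sym (bound≡ inv)) (ℤ.+<+ k<b)) ⇓arr) ⇓var))))) ,
      inv₆ (trans (cong (ℤ._- b) (bound≡ inv)) v≡y) , boxed , refl , time≡ n

  -- Induction on the number `m` of coordinates left. Each round costs `25 + 2 * n` for the body and
  -- 5 for the test; the last, failing test adds 5.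
  loop-correct : ∀ m i {σ} → i + m ≡ n → Invariant i σ →
    ∃[ σ′ ] ∃[ t ] ∃[ qs ]
      ((distanceTo y ⊢ while running body , σ ⇓ σ′ ∥ t ∥ qs)
       × Invariant n σ′
       × All (InBox k) qs
       × length qs ≡ 2 * m
       × t ≡ 5 + m * (30 + 2 * n))
  loop-correct zero i {σ} i+0≡n inv with refl ← trans (sym (+-identityʳ i)) i+0≡n =
    σ , _ , _ , ⇓stop exit , inv , [] , refl , refl
    where
    exit : False running σ
    exit rewrite idx≡ inv | len≡ inv = ℤ.+<+ (m<m+n n (s≤s z≤n))
  loop-correct (suc m) i {σ} i+1+m≡n inv
    with i<n ← subst (i <_) i+1+m≡n (m<m+n i (s≤s z≤n))
    -- `body-correct` takes its index in `Fin n`, so the invariant is transported along `toℕ-fromℕ<`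
    -- and back.
    with _ , _ , ps , run , inv′ , ps∈box , ∣ps∣ , t≡ ←
           body-correct (fromℕ< i<n) (subst (λ j → Invariant j σ) (sym (toℕ-fromℕ< i<n)) inv)
    with _ , _ , qs , runs , inv″ , qs∈box , ∣qs∣ , u≡ ←
           loop-correct m (suc i) (trans (sym (+-suc i m)) i+1+m≡n)
             (subst (λ j → Invariant (suc j) _) (toℕ-fromℕ< i<n) inv′) =
    _ , _ , _ , ⇓loop enter run runs , inv″ , ++⁺ ps∈box qs∈box ,
    trans (length-++ ps) (trans (cong₂ _+_ ∣ps∣ ∣qs∣) (sym (*-suc 2 m))) ,
    trans (cong (λ s → 5 + s) (cong₂ _+_ t≡ u≡)) (time≡ m n)
    where
    enter : True running σ
    enter rewrite idx≡ inv | len≡ inv =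
      ℤ.+≤+ (subst (_≤ n) (+-comm 1 i) (subst (i <_) i+1+m≡n (m<m+n i (s≤s z≤n))))
    time≡ : ∀ m n → 5 + ((25 + 2 * n) + (5 + m * (30 + 2 * n))) ≡ 5 + (suc m) * (30 + 2 * n)
    time≡ = solve-∀

  initial-invariant : Invariant 0 (initial n k)
  initial-invariant = record
    { len≡ = refl ; bound≡ = refl ; idx≡ = refl ; probe≡0 = λ _ → refl ; out≡y = λ _ () }

  output≡y : ∀ {σ} → Invariant n σ → output n σ ≡ y
  output≡y inv =
    trans (tabulate-cong (λ j → out≡y inv j (toℕ<n j))) (tabulate∘lookup y)

-- The constant is `37 = 5 + 30 + 2`, attained at `n = 1`. With `n = 1 + m` the slack below
-- `37 * n ^ 2` is `35 * (m * m) + 40 * m`.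
time-bound : ∀ n k → 1 ≤ n → 5 + n * (30 + 2 * n) ≤ 37 * (n + k) ^ 2
time-bound n@(suc m) k _ = begin
  5 + n * (30 + 2 * n)                          ≤⟨ m≤m+n _ (35 * (m * m) + 40 * m) ⟩
  5 + n * (30 + 2 * n) + (35 * (m * m) + 40 * m) ≡⟨ expand m ⟩
  37 * n ^ 2                                    ≤⟨ *-monoʳ-≤ 37 (^-monoˡ-≤ 2 (m≤m+n n k)) ⟩
  37 * (n + k) ^ 2                              ∎
  where
  open ≤-Reasoning
  expand : ∀ m → 5 + (1 + m) * (30 + 2 * (1 + m)) + (35 * (m * m) + 40 * m) ≡ 37 * ((1 + m) * ((1 + m) * 1))
  expand = solve-∀

mainTheorem3 : ∃[ algorithm ] ∃[ C ] ∃[ c ] ∃[ d ]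
    ((n k : ℕ) → 1 ≤ n → 1 ≤ k →
    (y : Vec ℤ n) → InBox k y →
    ∃[ σ ] ∃[ time ] ∃[ queries ]
    ((distanceTo y ⊢ algorithm , initial n k ⇓ σ ∥ time ∥ queries)
    × output n σ ≡ y
    × All (InBox k) queries
    × length queries ≤ C * n
    × time ≤ c * (n + k) ^ d))
mainTheorem3 = while running body , 2 , 37 , 2 , correct
  where
  correct : ∀ n k → 1 ≤ n → 1 ≤ k → (y : Vec ℤ n) → InBox k y → _
  correct n k 1≤n _ y y∈box
    -- The loop starts at coordinate 0 with all `n` coordinates left, hence asks `2 * n` queries.
    with σ , t , qs , run , inv , qs∈box , ∣qs∣ , t≡ ←
           loop-correct y y∈box n 0 refl (initial-invariant y y∈box) =
    σ , t , qs , run , output≡y y y∈box inv , qs∈box , ≤-reflexive ∣qs∣ ,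
    ≤-trans (≤-reflexive t≡) (time-bound n k 1≤n)
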